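{- Let $n\ge 1$ and let $Z$ be a double helix of order $n$ whose initial string $\tau$ of length $n$ is neither the all-zero nor the all-one string. Let $Y$ be the initial string of length $2^n-1$ of either $EM_n(Z)$ or $EM(Z)$. Then the path in ${\cal B}^n$ induced by $\tau_-Y$ is the message loop of $Z$ (i.e. it is a closed path traversing each edge of the message loop exactly once), and $ZY$ is a depleted DeBruijn string of order $n+1$.
   Context: All strings are over the alphabet $\{0,1\}$; for a digit $y$, $y' = 1-y$; $\tau_-$ denotes $\tau$ with its last digit removed. A DeBruijn string of order $m$ is a binary string of length $2^m+m-1$ that contains every binary string of length $m$ as a (contiguous) substring. A depleted DeBruijn string of order $m$ is a binary string that contains every string of length $m$ exactly once, except that one or both of the all-zero and all-one strings of length $m$ do not occur in it. The DeBruijn graph ${\cal B}^n$ is the directed graph whose vertices are the binary strings of length $n$, with an edge from $x\rho$ (with $x$ a digit, $|\rho|=n-1$) to each of $\rho0$ and $\rho1$, and no other edges. A binary string of length at least $n$ induces a path in ${\cal B}^n$ visiting in order its successive substrings of length $n$. A DeBruijn string $X$ of order $n$ begins and ends with the same string of length $n-1$, so its induced path visits every vertex once and closes up, by the edge from its last vertex to its first, to a Hamiltonian circuit of ${\cal B}^n$. $X$ is a double helix (of order $n$) if the graph obtained from ${\cal B}^n$ by removing the edges of this circuit has exactly 3 connected components; two of these are the loops at the all-zero and all-one strings, and the remaining one is a directed cycle, called the message loop of $X$. Definition of $EM(Z)$ and $EM_n(Z)$ for $n\ge1$ and a nonempty finite binary string $Z$: each is an infinite binary sequence $x_1x_2x_3\dots$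 generated digit by digit as follows. Suppose $x_1,\dots,x_k$ ($k\ge 0$) have been generated and let $W = Zx_1\cdots x_k$. Let $\sigma$ be the longest tail (suffix, possibly empty) of $W$ — for $EM_n(Z)$, the longest one among those with $|\sigma|\le n$; for $EM(Z)$, with no length restriction — that also occurs as a substring of $W$ with its last digit removed. Take the latest (rightmost) such earlier occurrence and let $y$ be the digit of $W$ immediately following it; if $\sigma$ is empty, $y$ is the last digit of $W$. Then $x_{k+1} = y'$. The sequences do not include the seed $Z$. -}

module Defs where

open import Data.Bool.Base using (Bool; true; false; not)
import Data.Bool.Properties as Bool
open import Data.Empty using (⊥-elim)
open import Data.Fin.Base using (Fin)
open import Data.List.Base
  using (List; []; _∷_; _++_; _∷ʳ_; length; take; drop; tails; mapMaybe; zip; applyUpTo)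
open import Data.List.Membership.Propositional using (_∈_; _∉_)
open import Data.List.Properties using (applyUpTo-∷ʳ; ++-assoc; ++-identityʳ; ∷-injective)
open import Data.List.Relation.Binary.Infix.Heterogeneous using (Infix; here; there)
open import Data.List.Relation.Binary.Infix.Heterogeneous.Properties using (infix?)
open import Data.List.Relation.Binary.Pointwise using (Pointwise-≡⇒≡; ≡⇒Pointwise-≡)
open import Data.List.Relation.Binary.Prefix.Heterogeneous
  using (Prefix; []; _∷_; fromView) renaming (_++_ to _⊹_)
open import Data.List.Relation.Binary.Suffix.Heterogeneous using (Suffix; here; there)
import Data.List.Relation.Binary.Suffix.Heterogeneous.Properties as Suffix
open import Data.List.Relation.Unary.Unique.Propositional using (Unique)
open import Data.Maybe.Base as Maybe using (Maybe; just; nothing)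
open import Data.Nat.Base using (ℕ; zero; suc; _+_; _∸_; _^_; _≤_; z≤n; s≤s)
open import Data.Nat.Properties using (_≤?_; ≤-refl; suc-injective)
open import Data.Product using (Σ; ∃; ∃-syntax; ∃!; _×_; _,_; proj₁; proj₂)
open import Data.Sum using (_⊎_; inj₁; inj₂)
open import Data.Unit.Base using (tt)
open import Data.Vec.Base using (Vec; []; _∷_; toList; replicate) renaming (_∷ʳ_ to _▹_)
open import Function.Base using (_∘_)
open import Function.Bundles using (_⇔_)
open import Function.Definitions using (StrictlySurjective)
open import Level using (0ℓ)
open import Relation.Binary.Construct.Closure.Equivalence using (EqClosure)
open import Relation.Binary.Core using (Rel)
open import Relation.Binary.PropositionalEquality
open import Relation.Nullary using (¬_; yes; no)
open import Relation.Nullary.Decidable using (_×-dec_)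
open import Relation.Unary using (Pred; Decidable; U)

------------------------------------------------------------------------
-- Strings

Str : Set
Str = List Bool

Tail Substring : Rel Str 0ℓ
Tail      = Suffix _≡_
Substring = Infix _≡_

OccursAt : ℕ → Str → Str → Set
OccursAt i σ W = ∃[ u ] ∃[ v ] length u ≡ i × W ≡ u ++ σ ++ v

OccursOnce : Str → Str → Set
OccursOnce σ W = ∃! _≡_ λ i → OccursAt i σ W

dropLast : Str → Str
dropLast W = take (length W ∸ 1) W

zeros ones : ∀ m → Vec Bool m
zeros m = replicate m false
ones  m = replicate m true

DeBruijn : ℕ → Str → Set
DeBruijn m X =
  length X ≡ (2 ^ m + m) ∸ 1 × (∀ (w : Vec Bool m) → Substring (toList w) X)

Depleted : ℕ → Str → Set
Depleted m X =
  (∀ (w : Vec Bool m) → w ≢ zeros m → w ≢ ones m → once w)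
  × (absent (zeros m) × once   (ones m)
   ⊎ once   (zeros m) × absent (ones m)
   ⊎ absent (zeros m) × absent (ones m))
  where
  once absent : Vec Bool m → Set
  once   w = OccursOnce (toList w) X
  absent w = ¬ Substring (toList w) X

------------------------------------------------------------------------
-- DeBruijn graphs

data Edge : ∀ {n} → Rel (Vec Bool n) 0ℓ where
  edge : ∀ {m} x (ρ : Vec Bool m) y {v} → v ≡ ρ ▹ y → Edge (x ∷ ρ) v

initial : ∀ n → Str → Maybe (Vec Bool n)
initial zero    W       = just []
initial (suc n) []      = nothing
initial (suc n) (a ∷ W) = Maybe.map (a ∷_) (initial n W)

-- The tails of W shorter than n have no initial string of length n, so
-- this lists the successive substrings of length n of W.
inducedPath : ∀ n → Str → List (Vec Bool n)
inducedPath n W = mapMaybe (initial n) (tails W)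

steps : {A : Set} → List A → List (A × A)
steps vs = zip vs (drop 1 vs)

closingUp : {A : Set} → List A → List A
closingUp []       = []
closingUp (v ∷ vs) = v ∷ vs ∷ʳ v

circuit : ∀ n → Str → List (Vec Bool n × Vec Bool n)
circuit n X = steps (closingUp (inducedPath n X))

Remaining : ∀ n → Str → Rel (Vec Bool n) 0ℓ
Remaining n X u v = Edge u v × (u , v) ∉ circuit n X

-- Connectedness ignores the direction of edges; c sends each vertex to
-- the label of its component.
HasComponents : ℕ → {V : Set} → Rel V 0ℓ → Set
HasComponents k {V} R =
  Σ (V → Fin k) λ c →
    StrictlySurjective _≡_ c × (∀ u v → c u ≡ c v ⇔ EqClosure R u v)

DoubleHelix : ℕ → Str → Set
DoubleHelix n X = DeBruijn n X × HasComponents 3 (Remaining n X)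

-- The edges of the component other than the loops at the all-zero and
-- all-one strings.
MessageLoop : ∀ n → Str → Rel (Vec Bool n) 0ℓ
MessageLoop n X u v =
  Remaining n X u v
  × ¬ EqClosure (Remaining n X) u (zeros n)
  × ¬ EqClosure (Remaining n X) u (ones n)

Closed : {A : Set} → List A → Set
Closed p = ∃[ v ] ∃[ vs ] p ≡ v ∷ vs ∷ʳ v

TraversesOnce : {A : Set} → List A → Rel A 0ℓ → Set
TraversesOnce p R = Unique (steps p) × (∀ u v → (u , v) ∈ steps p ⇔ R u v)

------------------------------------------------------------------------
-- EM sequences

-- Next P W b: the digit b is the one generated after W, when only tails
-- satisfying P are considered.  An empty σ needs no separate clause: its
-- latest occurrence in dropLast W is at the very end, so that y is the
-- last digit of W.
record Next (P : Pred Str 0ℓ) (W : Str) (b : Bool) : Set where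
  field
    σ        : Str
    allowed  : P σ
    tail     : Tail σ W
    earlier  : Substring σ (dropLast W)
    longest  : ∀ σ′ → P σ′ → Tail σ′ W → Substring σ′ (dropLast W) →
               length σ′ ≤ length σ
    i        : ℕ
    occurs   : OccursAt i σ (dropLast W)
    latest   : ∀ j → OccursAt j σ (dropLast W) → j ≤ i
    y        : Bool
    followed : OccursAt i (σ ∷ʳ y) W
    opposite : b ≡ not y

-- The sequence x₁x₂x₃… is indexed from 0: x k is the digit xₖ₊₁.
GeneratedFrom : Pred Str 0ℓ → Str → (ℕ → Bool) → Set
GeneratedFrom P Z x = ∀ k → Next P (Z ++ applyUpTo x k) (x k)

IsEM : Str → (ℕ → Bool) → Set
IsEM = GeneratedFrom U

IsEMₙ : ℕ → Str → (ℕ → Bool) → Set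
IsEMₙ n = GeneratedFrom λ σ → length σ ≤ n

------------------------------------------------------------------------
-- EM sequences exist for every nonempty seed

private
  longestTail : ∀ {Q : Pred Str 0ℓ} → Decidable Q → Q [] → ∀ W →
    ∃[ σ ] Tail σ W × Q σ × (∀ σ′ → Tail σ′ W → Q σ′ → length σ′ ≤ length σ)
  longestTail Q? q [] = [] , here (≡⇒Pointwise-≡ refl) , q , λ _ t _ → Suffix.length-mono t
  longestTail {Q} Q? q (a ∷ W) with Q? (a ∷ W)
  ... | yes qW = a ∷ W , here (≡⇒Pointwise-≡ refl) , qW , λ _ t _ → Suffix.length-mono t
  ... | no ¬qW with longestTail Q? q W
  ...   | σ , t , qσ , max = σ , there t , qσ , λ where
          σ′ (here eq)  q′ → ⊥-elim (¬qW (subst Q (Pointwise-≡⇒≡ eq) q′))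
          σ′ (there t′) q′ → max σ′ t′ q′

  occursAt⇒substring : ∀ {i σ} V → OccursAt i σ V → Substring σ V
  occursAt⇒substring _ ([] , v , _ , refl) =
    here (fromView (≡⇒Pointwise-≡ refl ⊹ v))
  occursAt⇒substring _ (a ∷ u , v , _ , refl) =
    there (occursAt⇒substring (u ++ _) (u , v , refl , refl))

  prefix-split : ∀ {σ V : Str} → Prefix _≡_ σ V → ∃[ v ] V ≡ σ ++ v
  prefix-split {V = V} [] = V , refl
  prefix-split (refl ∷ p) with prefix-split p
  ... | v , eq = v , cong (_ ∷_) eq

  latestOccurrence : ∀ σ V → Substring σ V →
    ∃[ i ] OccursAt i σ V × (∀ j → OccursAt j σ V → j ≤ i)
  latestOccurrence σ [] (here []) = 0 , ([] , [] , refl , refl) , λ where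
    _ ([] , _ , refl , _) → z≤n
  latestOccurrence σ (a ∷ V) s with infix? Bool._≟_ σ V
  ... | yes s′ with latestOccurrence σ V s′
  ...   | i , (u , v , refl , refl) , max = suc i , (a ∷ u , v , refl , refl) , λ where
          _ ([]    , _  , refl , _)  → z≤n
          _ (_ ∷ u′ , v′ , refl , eq) → s≤s (max _ (u′ , v′ , refl , proj₂ (∷-injective eq)))
  latestOccurrence σ (a ∷ V) (there s) | no ¬s = ⊥-elim (¬s s)
  latestOccurrence σ (a ∷ V) (here p)  | no ¬s with prefix-split p
  ... | v , eq = 0 , ([] , v , refl , eq) , λ where
    _ ([]    , _  , refl , _)  → z≤n
    _ (_ ∷ u′ , v′ , refl , e) →
      ⊥-elim (¬s (occursAt⇒substring V (u′ , v′ , refl , proj₂ (∷-injective e))))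

  dropLast-∷ʳ : ∀ a W → ∃[ d ] a ∷ W ≡ dropLast (a ∷ W) ∷ʳ d
  dropLast-∷ʳ a []      = a , refl
  dropLast-∷ʳ a (b ∷ W) with dropLast-∷ʳ b W
  ... | d , eq = d , cong (a ∷_) eq

  ∷ʳ-uncons : ∀ (v : Str) d → ∃[ y ] ∃[ v′ ] v ∷ʳ d ≡ y ∷ v′
  ∷ʳ-uncons []      d = d , [] , refl
  ∷ʳ-uncons (y ∷ v) d = y , v ∷ʳ d , refl

  follow : ∀ {i σ} W V d → W ≡ V ∷ʳ d → OccursAt i σ V → ∃[ y ] OccursAt i (σ ∷ʳ y) W
  follow {σ = σ} _ _ d refl (u , v , eq , refl) with ∷ʳ-uncons v d
  ... | y , v′ , e = y , u , v′ , eq , (begin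
      (u ++ σ ++ v) ++ d ∷ []    ≡⟨ ++-assoc u (σ ++ v) _ ⟩
      u ++ (σ ++ v) ++ d ∷ []    ≡⟨ cong (u ++_) (++-assoc σ v _) ⟩
      u ++ σ ++ v ++ d ∷ []      ≡⟨ cong (λ z → u ++ σ ++ z) e ⟩
      u ++ σ ++ y ∷ v′           ≡⟨ cong (u ++_) (++-assoc σ (y ∷ []) v′) ⟨
      u ++ (σ ++ y ∷ []) ++ v′   ∎)
    where open ≡-Reasoning

  next : ∀ {P} → Decidable P → P [] → ∀ a W → ∃ (Next P (a ∷ W))
  next P? p a W
    with longestTail (λ σ → P? σ ×-dec infix? Bool._≟_ σ (dropLast (a ∷ W)))
                     (p , here []) (a ∷ W)
  ... | σ , t , (q , s) , max with latestOccurrence σ _ s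
  ...   | i , o , late with dropLast-∷ʳ a W
  ...     | d , eq with follow (a ∷ W) _ d eq o
  ...       | y , f = not y , record
    { σ = σ ; allowed = q ; tail = t ; earlier = s
    ; longest = λ σ′ p′ t′ s′ → max σ′ t′ (p′ , s′)
    ; i = i ; occurs = o ; latest = late
    ; y = y ; followed = f ; opposite = refl }

generate : ∀ {P} → Decidable P → P [] → ∀ a Z → ∃ (GeneratedFrom P (a ∷ Z))
generate {P} P? p a Z = x , λ k →
  subst (λ W → Next P (a ∷ W) (x k)) (run≡ k) (proj₂ (next P? p a (run k)))
  where
  run : ℕ → Str
  x   : ℕ → Bool
  run zero    = Z
  run (suc k) = run k ∷ʳ proj₁ (next P? p a (run k))
  x k = proj₁ (next P? p a (run k))

  run≡ : ∀ k → run k ≡ Z ++ applyUpTo x k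
  run≡ zero    = sym (++-identityʳ Z)
  run≡ (suc k) = begin
    run k ∷ʳ x k                  ≡⟨ cong (_∷ʳ x k) (run≡ k) ⟩
    (Z ++ applyUpTo x k) ∷ʳ x k   ≡⟨ ++-assoc Z _ _ ⟩
    Z ++ applyUpTo x k ∷ʳ x k     ≡⟨ cong (Z ++_) (applyUpTo-∷ʳ x k) ⟩
    Z ++ applyUpTo x (suc k)      ∎
    where open ≡-Reasoning

EM-exists : ∀ a Z → ∃ (IsEM (a ∷ Z))
EM-exists = generate (λ _ → yes tt) tt

EMₙ-exists : ∀ n a Z → ∃ (IsEMₙ n (a ∷ Z))
EMₙ-exists n = generate (λ σ → length σ ≤? n) z≤n

{-# OPTIONS --safe #-}
-- Every string of length n occurs once in Z, and the last n - 1 digits of Z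
-- are its first n - 1.  At a string of length n that Y visits for the first
-- time, the longest repeated tail is that string itself: its occurrence in Z
-- is entered along an edge of the circuit of Z, while Y has entered it along
-- another edge.  Hence Y leaves it along the edge that Z does not use.  The
-- remaining edges form a permutation of the vertices, so Y runs through the
-- cycle of τ, which by the count of components contains every vertex other
-- than the all-zero and all-one strings, and so has length 2 ^ n - 2.
module Submission where

open import Defs
open import Data.Bool.Base using (Bool; true; false; not)
import Data.Bool.Properties as Bool
open import Data.Empty using (⊥-elim)
open import Data.Fin.Base using (Fin)
open import Data.Fin.Patterns using (0F; 1F; 2F; 3F)
import Data.Fin.Properties as Fin
open import Data.List.Base
  using (List; []; _∷_; _++_; _∷ʳ_; map; length; take; applyUpTo)
open import Data.List.Membership.Propositional using (_∈_)
open import Data.List.Membership.Propositional.Properties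
  using (∈-∃++; ∈-++⁺ˡ; ∈-++⁺ʳ; ∈-map⁺; ∈-map⁻; ∈-applyUpTo⁺; ∈-applyUpTo⁻)
open import Data.List.Properties
  using (map-++; map-∘; map-id; map-cong; length-++; length-map; length-applyUpTo; applyUpTo-∷ʳ;
         map-applyUpTo; ∷-injective; ∷-injectiveˡ; ∷ʳ-injectiveʳ; ++-identityʳ)
import Data.List.Relation.Binary.Infix.Heterogeneous as Infix
open import Data.List.Relation.Binary.Permutation.Propositional
  using (_↭_; ↭-refl; ↭-sym; ↭-trans; ↭-reflexive; prep; ↭⇒↭ₛ; module PermutationReasoning)
open import Data.List.Relation.Binary.Permutation.Propositional.Properties as Perm
  using (∈-resp-↭; shift; ↭-length; drop-∷; ∷↭∷ʳ; ↭-singleton-inv)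
open import Data.List.Relation.Binary.Permutation.Setoid.Properties using (Unique-resp-↭)
open import Data.List.Relation.Binary.Disjoint.Propositional using (Disjoint)
open import Data.List.Relation.Binary.Pointwise using (Pointwise-≡⇒≡; ≡⇒Pointwise-≡)
open import Data.List.Relation.Binary.Subset.Propositional using (_⊆_)
import Data.List.Relation.Binary.Suffix.Heterogeneous as Suffix
open import Data.List.Relation.Unary.All as All using ([]; _∷_)
import Data.List.Relation.Unary.All.Properties as All
open import Data.List.Relation.Unary.AllPairs using ([]; _∷_)
open import Data.List.Relation.Unary.Any using (here; there)
open import Data.List.Relation.Unary.Unique.Propositional using (Unique)
import Data.List.Relation.Unary.Unique.Propositional.Properties as Unique
open import Data.Maybe.Base as Maybe using (just; nothing)
open import Data.Nat.Base
  using (ℕ; zero; suc; _+_; _∸_; _^_; _≤_; _<_; z≤n; s≤s; z<s; s<s; s≤s⁻¹)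
open import Data.Nat.Properties
open import Data.Product using (∃; ∃-syntax; _×_; _,_; proj₁; proj₂)
open import Data.Sum using (_⊎_; inj₁; inj₂; [_,_]′)
open import Data.Unit.Base using (tt)
open import Data.Vec.Base as Vec
  using (Vec; []; _∷_; toList; initLast; lookup; replicate) renaming (_∷ʳ_ to _▹_)
open import Data.Vec.Properties as Vec
  using (≡-dec; ∷ʳ-injectiveˡ; init-∷ʳ; length-toList; toList-∷ʳ)
open import Function.Base using (_∘_)
open import Function.Bundles using (mk⇔; module Equivalence)
open import Level using (0ℓ)
open import Relation.Binary.Construct.Closure.Equivalence using (EqClosure; symmetric)
open import Relation.Binary.Construct.Closure.ReflexiveTransitive using (ε; _◅_)
open import Relation.Binary.Construct.Closure.Symmetric using (fwd; bwd)
open import Relation.Binary.Core using (Rel)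
open import Relation.Binary.Definitions using (tri<; tri≈; tri>)
open import Relation.Binary.PropositionalEquality
open import Relation.Nullary using (¬_; Dec; yes; no; contradiction)

-- Two points need more care than the rest. The first digit after `Z` is exceptional: the last n
-- digits of `Z` occur nowhere earlier in it, so the longest repeated tail has only n - 1 digits,
-- and it has two earlier occurrences. The rule that the latest one counts makes this digit complete
-- the closing edge of the circuit, so that the path starts at τ. After that, matching exactly n
-- digits at a vertex requires that the edge just traversed is new, which in turn rests on the
-- previous step having used a remaining edge. The steps are therefore proved by recursion, and only
-- as long as the visited vertices are distinct; that the first repetition is a return to τ is a
-- separate argument. Since no match is ever longer than n, the length bound of `IsEMₙ` never takes
-- effect. Read as edges, the strings of length n + 1 in `ZY` are the circuit followed by the
-- message loop, that is, all edges except the two loops.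

private
  variable
    A B : Set
    n : ℕ

-- Counting with lists without repetition

-- Pigeonhole in permutation form: an element matched in `ys` can be removed, because it does not
-- recur in `xs`. The leftover `zs` measures the difference in length.
unique⊆⇒extends : {xs ys : List A} → Unique xs → xs ⊆ ys → ∃[ zs ] xs ++ zs ↭ ys
unique⊆⇒extends {ys = ys} [] sub = ys , ↭-refl
unique⊆⇒extends {xs = x ∷ xs} (x∉ ∷ u) sub with ∈-∃++ (sub (here refl))
... | as , bs , refl = _ , ↭-trans (prep x (proj₂ rest)) (↭-sym (shift x as bs))
  where
  sub′ : xs ⊆ as ++ bs
  sub′ z∈ with ∈-resp-↭ (shift x as bs) (sub (there z∈))
  ... | here refl = ⊥-elim (All.lookup x∉ z∈ refl)
  ... | there z∈′ = z∈′
  rest = unique⊆⇒extends u sub′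

unique⊆⇒length≤ : {xs ys : List A} → Unique xs → xs ⊆ ys → length xs ≤ length ys
unique⊆⇒length≤ {xs = xs} {ys} u sub with unique⊆⇒extends u sub
... | zs , p = begin
  length xs                ≤⟨ m≤m+n _ _ ⟩
  length xs + length zs    ≡⟨ length-++ xs ⟨
  length (xs ++ zs)        ≡⟨ ↭-length p ⟩
  length ys                ∎
  where open ≤-Reasoning

unique⊆⇒↭ : {xs ys : List A} → Unique xs → xs ⊆ ys → length xs ≡ length ys → xs ↭ ys
unique⊆⇒↭ {xs = xs} {ys} u sub eq with unique⊆⇒extends u sub
... | [] , p = ↭-trans (↭-sym (Perm.++-identityʳ xs)) p
... | z ∷ zs , p with +-cancelˡ-≡ (length xs) 0 _ (begin
    length xs + 0                 ≡⟨ +-identityʳ _ ⟩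
    length xs                     ≡⟨ eq ⟩
    length ys                     ≡⟨ ↭-length p ⟨
    length (xs ++ z ∷ zs)         ≡⟨ length-++ xs ⟩
    length xs + suc (length zs)   ∎)
  where open ≡-Reasoning
...   | ()

applyUpTo-cong : {f g : ℕ → A} → (∀ i → f i ≡ g i) → ∀ k → applyUpTo f k ≡ applyUpTo g k
applyUpTo-cong eq zero    = refl
applyUpTo-cong eq (suc k) = cong₂ _∷_ (eq 0) (applyUpTo-cong (eq ∘ suc) k)

Distinct : (ℕ → A) → ℕ → Set
Distinct f k = ∀ {i j} → i < j → j < k → f i ≢ f j

distinct⇒injective : {f : ℕ → A} {k : ℕ} → Distinct f k →
                     ∀ {i j} → i < k → j < k → f i ≡ f j → i ≡ j
distinct⇒injective d {i} {j} i<k j<k eq with <-cmp i j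
... | tri< i<j _ _ = contradiction eq (d i<j j<k)
... | tri≈ _ i≡j _ = i≡j
... | tri> _ _ j<i = contradiction (sym eq) (d j<i i<k)

distinct⁻ : ∀ (f : ℕ → A) k → Unique (applyUpTo f k) → Distinct f k
distinct⁻ f (suc k) (f0∉ ∷ u) {zero}  {suc j} _         (s<s j<k) eq =
  All.applyUpTo⁻ (f ∘ suc) k f0∉ j<k eq
distinct⁻ f (suc k) (f0∉ ∷ u) {suc i} {suc j} (s<s i<j) (s<s j<k) eq =
  distinct⁻ (f ∘ suc) k u i<j j<k eq

-- The list of the values from `f 0` to `f k` is either list with one end attached; cancelling what
-- they share leaves `f k` against `f 0`.
applyUpTo-↭⇒ends≡ : ∀ (f : ℕ → A) k → applyUpTo f k ↭ applyUpTo (f ∘ suc) k → f 0 ≡ f k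
applyUpTo-↭⇒ends≡ f k p = sym (∷-injectiveˡ (↭-singleton-inv (cancel (applyUpTo f k) (begin
  applyUpTo f k ∷ʳ f k            ≡⟨ applyUpTo-∷ʳ f k ⟩
  f 0 ∷ applyUpTo (f ∘ suc) k     ↭⟨ prep (f 0) (↭-sym p) ⟩
  f 0 ∷ applyUpTo f k             ↭⟨ ∷↭∷ʳ (f 0) _ ⟩
  applyUpTo f k ∷ʳ f 0            ∎))))
  where
  open PermutationReasoning
  cancel : ∀ xs {ys zs} → xs ++ ys ↭ xs ++ zs → ys ↭ zs
  cancel []       q = q
  cancel (x ∷ xs) q = cancel xs (drop-∷ q)

-- Enumerations of the binary strings of a given length

-- The digit may be put in front or at the end: both enumerations are needed to compare final and
-- initial parts in `covers⇒closes`.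
branch : (Bool → A → B) → List A → List B
branch f xs = map (f false) xs ++ map (f true) xs

module _ (f : Bool → A → B) where

  branch-unique : (∀ {b c x y} → f b x ≡ f c y → b ≡ c × x ≡ y) →
                  ∀ {xs} → Unique xs → Unique (branch f xs)
  branch-unique inj {xs} u =
    Unique.++⁺ (Unique.map⁺ (proj₂ ∘ inj) u) (Unique.map⁺ (proj₂ ∘ inj) u) disjoint
    where
    disjoint : Disjoint (map (f false) xs) (map (f true) xs)
    disjoint (p , q) with ∈-map⁻ (f false) p | ∈-map⁻ (f true) q
    ... | _ , _ , refl | _ , _ , eq with inj eq
    ...   | () , _

  branch-∈ : ∀ b {x xs} → x ∈ xs → f b x ∈ branch f xs
  branch-∈ false         x∈ = ∈-++⁺ˡ (∈-map⁺ (f false) x∈)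
  branch-∈ true {xs = xs} x∈ = ∈-++⁺ʳ (map (f false) xs) (∈-map⁺ (f true) x∈)

  map-branch : (g : B → A) → (∀ b x → g (f b x) ≡ x) → ∀ xs → map g (branch f xs) ≡ xs ++ xs
  map-branch g gf xs = trans (map-++ g (map (f false) xs) _) (cong₂ _++_ (half false) (half true))
    where
    half : ∀ b → map g (map (f b) xs) ≡ xs
    half b = trans (sym (map-∘ xs)) (trans (map-cong (gf b) xs) (map-id xs))

  length-branch : ∀ xs → length (branch f xs) ≡ length xs + length xs
  length-branch xs =
    trans (length-++ (map (f false) xs))
          (cong₂ _+_ (length-map (f false) xs) (length-map (f true) xs))

vectors : ∀ n → List (Vec Bool n)
vectors zero    = [] ∷ []
vectors (suc n) = branch _∷_ (vectors n)

vectors-unique : ∀ n → Unique (vectors n)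
vectors-unique zero    = [] ∷ []
vectors-unique (suc n) = branch-unique _∷_ Vec.∷-injective (vectors-unique n)

∈-vectors : ∀ (v : Vec Bool n) → v ∈ vectors n
∈-vectors []      = here refl
∈-vectors (b ∷ v) = branch-∈ _∷_ b (∈-vectors v)

length-vectors : ∀ n → length (vectors n) ≡ 2 ^ n
length-vectors zero    = refl
length-vectors (suc n) = trans (length-branch _∷_ (vectors n))
  (cong₂ _+_ (length-vectors n) (trans (length-vectors n) (sym (+-identityʳ _))))

Covers : ∀ n → (ℕ → Vec Bool n) → Set
Covers n f = ∀ v → ∃[ i ] i < 2 ^ n × f i ≡ v

module _ {f : ℕ → Vec Bool n} (covers : Covers n f) where

  covers⇒↭ : ∀ {vs} → Unique vs → length vs ≡ 2 ^ n → vs ↭ applyUpTo f (2 ^ n)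
  covers⇒↭ u len = unique⊆⇒↭ u (λ {v} _ → ∈-covered v) (trans len (sym (length-applyUpTo f _)))
    where
    ∈-covered : ∀ v → v ∈ applyUpTo f (2 ^ n)
    ∈-covered v with covers v
    ... | i , i< , refl = ∈-applyUpTo⁺ f i<

  -- There are as many positions as strings, so covering every string leaves no room for a
  -- repetition.
  covers⇒distinct : Distinct f (2 ^ n)
  covers⇒distinct = distinct⁻ f _ (Unique-resp-↭ (setoid _)
    (↭⇒↭ₛ (covers⇒↭ (vectors-unique n) (length-vectors n))) (vectors-unique n))

-- Every string of length m is the initial part of two strings of length
-- m + 1 and the final part of two, so over all windows the initial parts
-- and the final parts form the same multiset.
covers⇒closes : ∀ {m} {f : ℕ → Vec Bool (suc m)} (g : ℕ → Vec Bool m) →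
                Covers (suc m) f → (∀ i → Vec.init (f i) ≡ g i) →
                (∀ i → Vec.tail (f i) ≡ g (suc i)) →
                g (2 ^ suc m) ≡ g 0
covers⇒closes {m} {f} g covers init≡ tail≡ = sym (applyUpTo-↭⇒ends≡ g N (begin
  applyUpTo g N
    ↭⟨ same Vec.init init≡ (covers⇒↭ covers snocs-unique snocs-length) ⟨
  map Vec.init (branch snoc (vectors m))
    ≡⟨ map-branch snoc Vec.init init-∷ʳ (vectors m) ⟩
  vectors m ++ vectors m
    ≡⟨ map-branch _∷_ Vec.tail (λ _ _ → refl) (vectors m) ⟨
  map Vec.tail (vectors (suc m))
    ↭⟨ same Vec.tail tail≡ (covers⇒↭ covers (vectors-unique (suc m)) (length-vectors (suc m))) ⟩
  applyUpTo (g ∘ suc) N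
    ∎))
  where
  open PermutationReasoning
  N = 2 ^ suc m

  snoc : Bool → Vec Bool m → Vec Bool (suc m)
  snoc b v = v ▹ b

  snocs-unique : Unique (branch snoc (vectors m))
  snocs-unique = branch-unique snoc
    (λ eq → Vec.∷ʳ-injectiveʳ _ _ eq , ∷ʳ-injectiveˡ _ _ eq) (vectors-unique m)

  snocs-length : length (branch snoc (vectors m)) ≡ N
  snocs-length = trans (length-branch snoc (vectors m))
    (trans (sym (length-branch _∷_ (vectors m))) (length-vectors (suc m)))

  same : ∀ (h : Vec Bool (suc m) → Vec Bool m) {h′} → (∀ i → h (f i) ≡ h′ i) →
         ∀ {vs} → vs ↭ applyUpTo f N → map h vs ↭ applyUpTo h′ N
  same h eq p = ↭-trans (Perm.map⁺ h p)
    (↭-reflexive (trans (map-applyUpTo f h N) (applyUpTo-cong eq N)))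

-- Occurrences and windows of a digit sequence

occursAt⇒substring : ∀ {i σ W} → OccursAt i σ W → Substring σ W
occursAt⇒substring (u , v , _ , refl) = Infix.fromView (Infix.MkView u (≡⇒Pointwise-≡ refl) v)

substring⇒occursAt : ∀ {σ W} → Substring σ W → ∃[ i ] OccursAt i σ W
substring⇒occursAt s with Infix.toView s
... | Infix.MkView u p v with Pointwise-≡⇒≡ p
...   | refl = _ , u , v , refl , refl

inducedPath-short : ∀ {m} W → length W ≤ m → inducedPath (suc m) W ≡ []
inducedPath-short []      _  = refl
inducedPath-short {suc m} (b ∷ W) (s≤s W≤) =
  trans (skip (initial-short W W≤)) (inducedPath-short W (m≤n⇒m≤1+n W≤))
  where
  initial-short : ∀ {m} W → length W ≤ m → initial (suc m) W ≡ nothing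
  initial-short []      _ = refl
  initial-short {suc m} (b ∷ W) (s≤s W≤) = cong (Maybe.map (b ∷_)) (initial-short W W≤)

  skip : initial (suc m) W ≡ nothing →
         inducedPath (suc (suc m)) (b ∷ W) ≡ inducedPath (suc (suc m)) W
  skip eq rewrite eq = refl

toList-injective′ : ∀ {n} {u v : Vec Bool n} → toList u ≡ toList v → u ≡ v
toList-injective′ {u = u} {v} eq =
  trans (sym (Vec.cast-is-id refl u)) (Vec.toList-injective refl u v eq)

module Windows (w : ℕ → Bool) where

  -- Windows of one infinite sequence never run out of range, and occurrences of strings become
  -- equalities of windows at given positions.
  win : ∀ ℓ → ℕ → Vec Bool ℓ
  win zero    i = []
  win (suc ℓ) i = w i ∷ win ℓ (suc i)

  seg : ℕ → ℕ → Str
  seg ℓ i = toList (win ℓ i)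

  win-▹ : ∀ ℓ i → win (suc ℓ) i ≡ win ℓ i ▹ w (i + ℓ)
  win-▹ zero    i = cong (λ j → w j ∷ []) (sym (+-identityʳ i))
  win-▹ (suc ℓ) i = cong (w i ∷_)
    (trans (win-▹ ℓ (suc i)) (cong (λ j → win ℓ (suc i) ▹ w j) (sym (+-suc i ℓ))))

  win-drop : ∀ c {r a b} → win (c + r) a ≡ win (c + r) b → win r (c + a) ≡ win r (c + b)
  win-drop zero    eq = eq
  win-drop (suc c) {r} {a} {b} eq =
    subst₂ (λ i j → win r i ≡ win r j) (+-suc c a) (+-suc c b)
      (win-drop c (Vec.∷-injectiveʳ eq))

  length-seg : ∀ ℓ i → length (seg ℓ i) ≡ ℓ
  length-seg ℓ i = length-toList (win ℓ i)

  seg-++ : ∀ a b i → seg (a + b) i ≡ seg a i ++ seg b (a + i)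
  seg-++ zero    b i = refl
  seg-++ (suc a) b i = cong (w i ∷_)
    (trans (seg-++ a b (suc i)) (cong (λ j → seg a (suc i) ++ seg b j) (+-suc a i)))

  seg-split : ∀ u {s L i} → seg L i ≡ u ++ s →
    L ≡ length u + length s × u ≡ seg (length u) i × s ≡ seg (length s) (length u + i)
  seg-split [] {L = L} {i} refl =
    sym (length-seg L i) , refl , cong (λ ℓ → seg ℓ i) (sym (length-seg L i))
  seg-split (b ∷ u) {s} {suc L} {i} eq with ∷-injective eq
  ... | eq₁ , eq₂ with seg-split u eq₂
  ...   | L≡ , u≡ , s≡ = cong suc L≡ , cong₂ _∷_ (sym eq₁) u≡ ,
            trans s≡ (cong (seg (length s)) (+-suc (length u) i))

  occursAt⁻ : ∀ {i σ L} → OccursAt i σ (seg L 0) → i + length σ ≤ L × σ ≡ seg (length σ) i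
  occursAt⁻ {σ = σ} {L} (u , v , refl , eq) with seg-split u eq
  ... | L≡ , _ , σv≡ with seg-split σ (sym σv≡)
  ...   | σv-length , σ≡ , _ =
    (begin
      length u + length σ                 ≤⟨ +-monoʳ-≤ (length u) (m≤m+n _ _) ⟩
      length u + (length σ + length v)    ≡⟨ cong (length u +_) σv-length ⟨
      length u + length (σ ++ v)          ≡⟨ L≡ ⟨
      L                                   ∎) ,
    trans σ≡ (cong (seg (length σ)) (+-identityʳ _))
    where open ≤-Reasoning

  occursAt⁺ : ∀ {i ℓ L} → i + ℓ ≤ L → OccursAt i (seg ℓ i) (seg L 0)
  occursAt⁺ {i} {ℓ} {L} i+ℓ≤L = seg i 0 , seg r (ℓ + i) , length-seg i 0 , (begin
    seg L 0                                  ≡⟨ cong (λ k → seg k 0) (m+[n∸m]≡n i+ℓ≤L) ⟨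
    seg (i + ℓ + r) 0                        ≡⟨ cong (λ k → seg k 0) (+-assoc i ℓ r) ⟩
    seg (i + (ℓ + r)) 0                      ≡⟨ seg-++ i (ℓ + r) 0 ⟩
    seg i 0 ++ seg (ℓ + r) (i + 0)           ≡⟨ cong (λ k → seg i 0 ++ seg (ℓ + r) k) (+-identityʳ i) ⟩
    seg i 0 ++ seg (ℓ + r) i                 ≡⟨ cong (seg i 0 ++_) (seg-++ ℓ r i) ⟩
    seg i 0 ++ seg ℓ i ++ seg r (ℓ + i)      ∎)
    where
    open ≡-Reasoning
    r = L ∸ (i + ℓ)

  occursAt-toList⁻ : ∀ {ℓ L i} (v : Vec Bool ℓ) → OccursAt i (toList v) (seg L 0) →
                     i + ℓ ≤ L × win ℓ i ≡ v
  occursAt-toList⁻ {ℓ} {L} {i} v o =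
    subst (λ k → i + k ≤ L) (length-toList v) (proj₁ (occursAt⁻ o)) ,
    toList-injective′ (sym (trans (proj₂ (occursAt⁻ o)) (cong (λ k → seg k i) (length-toList v))))

  tail⁻ : ∀ {σ L} → Tail σ (seg L 0) → ∃[ a ] a + length σ ≡ L × σ ≡ seg (length σ) a
  tail⁻ {σ} {L} t = go refl (Suffix.toView t)
    where
    go : ∀ {W} → seg L 0 ≡ W → Suffix.SuffixView _≡_ σ W →
         ∃[ a ] a + length σ ≡ L × σ ≡ seg (length σ) a
    go eq (u Suffix.++ p) with Pointwise-≡⇒≡ p
    ... | refl with seg-split u eq
    ...   | L≡ , _ , σ≡ = length u , sym L≡ ,
              trans σ≡ (cong (seg (length σ)) (+-identityʳ _))

  tail⁺ : ∀ a ℓ → Tail (seg ℓ a) (seg (a + ℓ) 0)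
  tail⁺ a ℓ = subst (Tail (seg ℓ a))
    (trans (cong (λ i → seg a 0 ++ seg ℓ i) (sym (+-identityʳ a))) (sym (seg-++ a ℓ 0)))
    (Suffix.fromView (seg a 0 Suffix.++ ≡⇒Pointwise-≡ refl))

  take-seg : ∀ ℓ r i → take ℓ (seg (ℓ + r) i) ≡ seg ℓ i
  take-seg zero    r i = refl
  take-seg (suc ℓ) r i = cong (w i ∷_) (take-seg ℓ r (suc i))

  dropLast-seg : ∀ L i → dropLast (seg (suc L) i) ≡ seg L i
  dropLast-seg L i = begin
    take (length (seg (suc L) i) ∸ 1) (seg (suc L) i)
      ≡⟨ cong (λ k → take (k ∸ 1) (seg (suc L) i)) (length-seg (suc L) i) ⟩
    take L (seg (1 + L) i)
      ≡⟨ cong (λ k → take L (seg k i)) (+-comm 1 L) ⟩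
    take L (seg (L + 1) i)
      ≡⟨ take-seg L 1 i ⟩
    seg L i
      ∎
    where open ≡-Reasoning

  inducedPath-seg : ∀ m k i →
    inducedPath (suc m) (seg (k + suc m) i) ≡ applyUpTo (λ j → win (suc m) (j + i)) (suc k)
  inducedPath-seg m k i = trans (uncons k) (cong (win (suc m) i ∷_) (rest k))
    where
    initial-seg : ∀ n r i → initial n (seg (n + r) i) ≡ just (win n i)
    initial-seg zero    r i = refl
    initial-seg (suc n) r i = cong (Maybe.map (w i ∷_)) (initial-seg n r (suc i))

    keep : ∀ L → initial (suc m) (seg (suc L) i) ≡ just (win (suc m) i) →
           inducedPath (suc m) (seg (suc L) i) ≡ win (suc m) i ∷ inducedPath (suc m) (seg L (suc i))
    keep L eq rewrite eq = refl

    uncons : ∀ k → inducedPath (suc m) (seg (k + suc m) i) ≡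
             win (suc m) i ∷ inducedPath (suc m) (seg (k + m) (suc i))
    uncons k rewrite +-suc k m = keep (k + m)
      (subst (λ L → initial (suc m) (seg (suc L) i) ≡ just (win (suc m) i)) (+-comm m k)
        (initial-seg (suc m) k i))

    rest : ∀ k → inducedPath (suc m) (seg (k + m) (suc i)) ≡
           applyUpTo (λ j → win (suc m) (suc j + i)) k
    rest zero    = inducedPath-short (seg m (suc i)) (≤-reflexive (length-seg m (suc i)))
    rest (suc k) = trans (cong (λ L → inducedPath (suc m) (seg L (suc i))) (sym (+-suc k m)))
      (trans (inducedPath-seg m k (suc i))
        (applyUpTo-cong (λ j → cong (win (suc m)) (+-suc j i)) (suc k)))

  -- The last ℓ digits have occurred before and the last suc ℓ digits have
  -- not, which forces length σ ≡ ℓ.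
  module _ {Q b ℓ a i₀} (short : ∀ σ → length σ ≤ ℓ → Q σ) (next : Next Q (seg (suc a + ℓ) 0) b)
           (i₀≤a : i₀ ≤ a) (repeats : win ℓ i₀ ≡ win ℓ (suc a))
           (fresh : ∀ j → j < a → win (suc ℓ) j ≢ win (suc ℓ) a) where

    open Next next

    private
      dropLast≡ : dropLast (seg (suc a + ℓ) 0) ≡ seg (a + ℓ) 0
      dropLast≡ = dropLast-seg (a + ℓ) 0

      ℓ≤length : ℓ ≤ length σ
      ℓ≤length = subst (_≤ length σ) (length-seg ℓ (suc a))
        (longest (seg ℓ (suc a)) (short _ (≤-reflexive (length-seg ℓ (suc a))))
          (tail⁺ (suc a) ℓ)
          (subst₂ Substring (cong toList repeats) (sym dropLast≡)
            (occursAt⇒substring (occursAt⁺ (+-monoˡ-≤ ℓ i₀≤a)))))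

      occurs⁻ : i + length σ ≤ a + ℓ × σ ≡ seg (length σ) i
      occurs⁻ = occursAt⁻ (subst (OccursAt i σ) dropLast≡ occurs)

      -- A match longer than `ℓ`, cut on the left down to `suc ℓ` digits, would be a copy of the
      -- window at `a` starting before `a`, against `fresh`.
      bound : ∀ s a′ → a′ + s ≡ suc a + ℓ → i + s ≤ a + ℓ → win s i ≡ win s a′ → s ≤ ℓ
      bound s a′ a′+s i+s eq with ≤-<-connex s ℓ
      ... | inj₁ s≤ℓ = s≤ℓ
      ... | inj₂ ℓ<s with m≤n⇒∃[o]m+o≡n ℓ<s
      ...   | c , refl = ⊥-elim (fresh (c + i) c+i<a
                (subst (λ k → win (suc ℓ) (c + i) ≡ win (suc ℓ) k) c+a′≡a
                  (win-drop c (subst (λ s → win s i ≡ win s a′) (+-comm (suc ℓ) c) eq))))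
        where
        rearrange : ∀ k → k + (suc ℓ + c) ≡ suc (c + k) + ℓ
        rearrange k = trans (+-comm k _) (cong suc (trans (+-assoc ℓ c k) (+-comm ℓ _)))
        c+a′≡a : c + a′ ≡ a
        c+a′≡a = suc-injective (+-cancelʳ-≡ ℓ _ _ (trans (sym (rearrange a′)) a′+s))
        c+i<a : c + i < a
        c+i<a = +-cancelʳ-≤ ℓ _ _ (subst (_≤ a + ℓ) (rearrange i) i+s)

      length≡ : length σ ≡ ℓ
      length≡ with tail⁻ tail
      ... | a′ , a′+s , σ≡ = ≤-antisym
        (bound _ a′ a′+s (proj₁ occurs⁻) (toList-injective′ (trans (sym (proj₂ occurs⁻)) σ≡)))
        ℓ≤length

      σ≡seg : σ ≡ seg ℓ i
      σ≡seg = trans (proj₂ occurs⁻) (cong (λ s → seg s i) length≡)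

      win≡ : win ℓ i ≡ win ℓ (suc a)
      win≡ with tail⁻ tail
      ... | a′ , a′+s , σ≡ = toList-injective′ (trans (sym σ≡seg) (trans σ≡ (cong₂ seg length≡
              (+-cancelʳ-≡ ℓ _ _ (trans (cong (a′ +_) (sym length≡)) a′+s)))))

      y≡ : y ≡ w (i + ℓ)
      y≡ = ∷ʳ-injectiveʳ σ (seg ℓ i) (begin
        σ ∷ʳ y                          ≡⟨ proj₂ (occursAt⁻ followed) ⟩
        seg (length (σ ∷ʳ y)) i         ≡⟨ cong (λ s → seg s i) (length-++ σ) ⟩
        seg (length σ + 1) i            ≡⟨ cong (λ s → seg s i)
                                            (trans (+-comm _ 1) (cong suc length≡)) ⟩
        seg (suc ℓ) i                   ≡⟨ cong toList (win-▹ ℓ i) ⟩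
        toList (win ℓ i ▹ w (i + ℓ))    ≡⟨ toList-∷ʳ _ (win ℓ i) ⟩
        seg ℓ i ∷ʳ w (i + ℓ)            ∎)
        where open ≡-Reasoning

    -- The last component, maximality of `i`, decides between the two earlier occurrences of the
    -- tail of `Z` in `first-digit`.
    next-window : ∃[ i ] i ≤ a × win ℓ i ≡ win ℓ (suc a) × b ≡ not (w (i + ℓ)) ×
                  (∀ j → j ≤ a → win ℓ j ≡ win ℓ (suc a) → j ≤ i)
    next-window = i , +-cancelʳ-≤ ℓ _ _ (subst (λ s → i + s ≤ a + ℓ) length≡ (proj₁ occurs⁻)) ,
      win≡ , trans opposite (cong not y≡) ,
      λ j j≤a eq → latest j (subst₂ (OccursAt j)
        (trans (cong toList (trans eq (sym win≡))) (sym σ≡seg)) (sym dropLast≡)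
        (occursAt⁺ (+-monoˡ-≤ ℓ j≤a)))

-- The cycle in a permutation graph with three components

-- Meant for component labels: two loop vertices and the start of the orbit use up all three, so any
-- further vertex belongs with the start.
fourth-of-three : ∀ (a b c d : Fin 3) → a ≢ b → a ≢ c → b ≢ c → a ≢ d → b ≢ d → c ≡ d
fourth-of-three a b c d a≢b a≢c b≢c a≢d b≢d
  with Fin.pigeonhole ≤-refl (lookup (a ∷ b ∷ c ∷ d ∷ []))
... | 0F , 1F , _ , eq = contradiction eq a≢b
... | 0F , 2F , _ , eq = contradiction eq a≢c
... | 0F , 3F , _ , eq = contradiction eq a≢d
... | 1F , 2F , _ , eq = contradiction eq b≢c
... | 1F , 3F , _ , eq = contradiction eq b≢d
... | 2F , 3F , _ , eq = eq
... | 1F , 1F , s≤s () , _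
... | 2F , 1F , s≤s () , _
... | 2F , 2F , s≤s (s≤s ()) , _
... | 3F , 1F , s≤s () , _
... | 3F , 2F , s≤s (s≤s ()) , _
... | 3F , 3F , s≤s (s≤s (s≤s ())) , _

module _ {A : Set} {R : Rel A 0ℓ} where

  eqClosure-invariant : ∀ {Q : A → Set} → (∀ {u v} → R u v → Q u → Q v) →
    (∀ {u v} → R u v → Q v → Q u) → ∀ {u v} → EqClosure R u v → Q u → Q v
  eqClosure-invariant forth back ε            q = q
  eqClosure-invariant forth back (fwd r ◅ rs) q = eqClosure-invariant forth back rs (forth r q)
  eqClosure-invariant forth back (bwd r ◅ rs) q = eqClosure-invariant forth back rs (back r q)

-- `follows` is conditional because a generated digit is under control only at a first visit.
-- Finiteness then yields a first repetition, and injectivity places it at `f 0`.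
module Loop {n} {R : Rel (Vec Bool n) 0ℓ}
  (functional : ∀ {u v v′} → R u v → R u v′ → v ≡ v′)
  (injective : ∀ {u u′ v} → R u v → R u′ v → u ≡ u′)
  (components : HasComponents 3 R)
  {a b : Vec Bool n} (a≢b : a ≢ b) (loop-a : R a a) (loop-b : R b b)
  (f : ℕ → Vec Bool n) (f0≢a : f 0 ≢ a) (f0≢b : f 0 ≢ b)
  (follows : ∀ k → Distinct f (suc k) → R (f k) (f (suc k))) where

  loop-class : ∀ {l u} → R l l → EqClosure R l u → u ≡ l
  loop-class {l} loop rs = eqClosure-invariant {Q = _≡ l}
    (λ { r refl → functional r loop }) (λ { r refl → injective r loop }) rs refl

  Returns : ℕ → Set
  Returns l = Distinct f (suc l) × f (suc l) ≡ f 0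

  distinct-or-returns : ∀ k → Distinct f (suc k) ⊎ ∃ Returns
  distinct-or-returns zero = inj₁ λ { i<j (s≤s z≤n) → ⊥-elim (n≮0 i<j) }
  distinct-or-returns (suc k) with distinct-or-returns k
  ... | inj₂ returns = inj₂ returns
  ... | inj₁ d with anyUpTo? (λ i → ≡-dec Bool._≟_ (f i) (f (suc k))) (suc k)
  ...   | yes (zero , _ , eq) = inj₂ (k , d , sym eq)
  -- Here `f i` and `f k` would be two predecessors of one vertex, hence equal, although the values
  -- up to `f k` are distinct.
  ...   | yes (suc i , s<s i<k , eq) = ⊥-elim (d i<k (n<1+n k)
            (injective (follows i λ p q → d p (<-trans q (s<s i<k)))
              (subst (R (f k)) (sym eq) (follows k d))))
  ...   | no ¬repeat = inj₁ extended
    where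
    extended : Distinct f (suc (suc k))
    extended i<j j<2+k eq with m≤n⇒m<n∨m≡n (s≤s⁻¹ j<2+k)
    ... | inj₁ j<1+k = d i<j j<1+k eq
    ... | inj₂ refl  = ¬repeat (_ , i<j , eq)

  unique⇒length≤ : ∀ {vs : List (Vec Bool n)} → Unique vs → length vs ≤ 2 ^ n
  unique⇒length≤ {vs} u =
    subst (length vs ≤_) (length-vectors n) (unique⊆⇒length≤ u (λ {v} _ → ∈-vectors v))

  abstract
    returns : ∃ Returns
    -- The other outcome would give `suc (2 ^ n)` distinct strings of length `n`.
    returns with distinct-or-returns (2 ^ n)
    ... | inj₂ r = r
    ... | inj₁ d = ⊥-elim (1+n≰n (subst (_≤ 2 ^ n) (length-applyUpTo f _)
                     (unique⇒length≤ (Unique.applyUpTo⁺₁ f _ d))))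

  l : ℕ
  l = proj₁ returns

  distinct : Distinct f (suc l)
  distinct = proj₁ (proj₂ returns)

  closes : f (suc l) ≡ f 0
  closes = proj₂ (proj₂ returns)

  step : ∀ {k} → k ≤ l → R (f k) (f (suc k))
  step {k} k≤l = follows k λ i<j j<1+k → distinct i<j (≤-trans j<1+k (s≤s k≤l))

  OnOrbit : Vec Bool n → Set
  OnOrbit u = ∃[ k ] k ≤ l × f k ≡ u

  -- Each orbit vertex has its only successor and its only predecessor on the orbit, so undirected
  -- walks cannot leave it either.
  class⇒orbit : ∀ {u} → EqClosure R (f 0) u → OnOrbit u
  class⇒orbit rs = eqClosure-invariant {Q = OnOrbit} forth back rs (0 , z≤n , refl)
    where
    forth : ∀ {u v} → R u v → OnOrbit u → OnOrbit v
    forth r (k , k≤l , refl) with m≤n⇒m<n∨m≡n k≤l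
    ... | inj₁ k<l  = suc k , k<l , functional (step k≤l) r
    ... | inj₂ refl = 0 , z≤n , trans (sym closes) (functional (step k≤l) r)

    back : ∀ {u v} → R u v → OnOrbit v → OnOrbit u
    back r (suc k , k<l , refl) = k , <⇒≤ k<l , injective (step (<⇒≤ k<l)) r
    back r (zero  , _   , refl) = l , ≤-refl , injective (step ≤-refl) (subst (R _) (sym closes) r)

  -- A vertex with a loop is its own only predecessor, so it cannot be entered from elsewhere.
  orbit≢loop : ∀ {v} → R v v → f 0 ≢ v → ∀ k → k ≤ l → f k ≢ v
  orbit≢loop loop f0≢v zero    _   eq = f0≢v eq
  orbit≢loop loop f0≢v (suc k) k<l eq =
    orbit≢loop loop f0≢v k (<⇒≤ k<l) (injective (subst (R (f k)) eq (step (<⇒≤ k<l))) loop)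

  orbit≢a : ∀ k → k ≤ l → f k ≢ a
  orbit≢a = orbit≢loop loop-a f0≢a

  orbit≢b : ∀ k → k ≤ l → f k ≢ b
  orbit≢b = orbit≢loop loop-b f0≢b

  others-on-orbit : ∀ {u} → u ≢ a → u ≢ b → OnOrbit u
  others-on-orbit {u} u≢a u≢b = class⇒orbit (same (fourth-of-three (c a) (c b) (c (f 0)) (c u)
      (a≢b ∘ sym ∘ loop-class loop-a ∘ same) (f0≢a ∘ loop-class loop-a ∘ same)
      (f0≢b ∘ loop-class loop-b ∘ same)
      (u≢a ∘ loop-class loop-a ∘ same) (u≢b ∘ loop-class loop-b ∘ same)))
    where
    c : Vec Bool n → Fin 3
    c = proj₁ components
    same : ∀ {u v} → c u ≡ c v → EqClosure R u v
    same {u} {v} = Equivalence.to (proj₂ (proj₂ components) u v)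

  orbit-length : 2 ^ n ≡ 3 + l
  orbit-length = sym (begin
      3 + l            ≡⟨ cong (2 +_) (length-applyUpTo f (suc l)) ⟨
      length all       ≡⟨ ≤-antisym (unique⇒length≤ unique) vectors≤all ⟩
      2 ^ n            ∎)
    where
    open ≡-Reasoning
    all : List (Vec Bool n)
    all = a ∷ b ∷ applyUpTo f (suc l)

    unique : Unique all
    unique =
      (a≢b ∷ All.applyUpTo⁺₁ f _ (λ k≤l eq → orbit≢a _ (s≤s⁻¹ k≤l) (sym eq))) ∷
      All.applyUpTo⁺₁ f _ (λ k≤l eq → orbit≢b _ (s≤s⁻¹ k≤l) (sym eq)) ∷
      Unique.applyUpTo⁺₁ f _ distinct

    vectors⊆all : vectors n ⊆ all
    vectors⊆all {v} _ with ≡-dec Bool._≟_ v a | ≡-dec Bool._≟_ v b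
    ... | yes v≡a | _       = here v≡a
    ... | no _    | yes v≡b = there (here v≡b)
    ... | no v≢a  | no v≢b with others-on-orbit v≢a v≢b
    ...   | k , k≤l , refl = there (there (∈-applyUpTo⁺ f (s≤s k≤l)))

    vectors≤all : 2 ^ n ≤ length all
    vectors≤all = subst (_≤ length all) (length-vectors n)
      (unique⊆⇒length≤ (vectors-unique n) vectors⊆all)

-- Edges of the DeBruijn graph and steps of paths

-- Each vertex has two edges out and, for `edges-in`, two edges in. With `c` on the circuit, only
-- one choice remains.
edges-out : ∀ {n} {u a b c : Vec Bool n} → Edge u a → Edge u b → Edge u c → a ≢ c → b ≢ c → a ≡ b
edges-out (edge x ρ y₁ refl) (edge .x .ρ y₂ refl) (edge .x .ρ y₃ refl) a≢c b≢c =
  cong (ρ ▹_) (trans (Bool.¬-not (a≢c ∘ cong (ρ ▹_))) (sym (Bool.¬-not (b≢c ∘ cong (ρ ▹_)))))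

edges-in : ∀ {n} {a b c v : Vec Bool n} → Edge a v → Edge b v → Edge c v → a ≢ c → b ≢ c → a ≡ b
edges-in (edge x₁ ρ₁ y₁ refl) (edge x₂ ρ₂ y₂ eq₂) (edge x₃ ρ₃ y₃ eq₃) a≢c b≢c
  with ∷ʳ-injectiveˡ ρ₁ ρ₂ eq₂ | ∷ʳ-injectiveˡ ρ₁ ρ₃ eq₃
... | refl | refl =
  cong (_∷ ρ₁) (trans (Bool.¬-not (a≢c ∘ cong (_∷ ρ₁))) (sym (Bool.¬-not (b≢c ∘ cong (_∷ ρ₁)))))

replicate-▹ : ∀ m (b : Bool) → replicate (suc m) b ≡ replicate m b ▹ b
replicate-▹ zero    b = refl
replicate-▹ (suc m) b = cong (b ∷_) (replicate-▹ m b)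

loop-edge : ∀ m b → Edge (replicate (suc m) b) (replicate (suc m) b)
loop-edge m b = edge b (replicate m b) b (replicate-▹ m b)

stepAt : ∀ {A : Set} → (ℕ → A) → ℕ → A × A
stepAt f i = f i , f (suc i)

steps-applyUpTo : ∀ {A : Set} (f : ℕ → A) k →
  steps (applyUpTo f (suc k)) ≡ applyUpTo (stepAt f) k
steps-applyUpTo f zero    = refl
steps-applyUpTo f (suc k) = cong (stepAt f 0 ∷_) (steps-applyUpTo (f ∘ suc) k)

∈-steps⁺ : ∀ {A : Set} (f : ℕ → A) {i k} → i < k → stepAt f i ∈ steps (applyUpTo f (suc k))
∈-steps⁺ f {i} {k} i<k =
  subst (stepAt f i ∈_) (sym (steps-applyUpTo f k)) (∈-applyUpTo⁺ (stepAt f) i<k)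

∈-steps⁻ : ∀ {A : Set} (f : ℕ → A) {k u v} → (u , v) ∈ steps (applyUpTo f (suc k)) →
  ∃[ i ] i < k × u ≡ f i × v ≡ f (suc i)
∈-steps⁻ f {k} {u} {v} e
  with ∈-applyUpTo⁻ (stepAt f) (subst ((u , v) ∈_) (steps-applyUpTo f k) e)
... | i , i<k , refl = i , i<k , refl , refl

closingUp-applyUpTo : ∀ {A : Set} (f : ℕ → A) k → f (suc k) ≡ f 0 →
  closingUp (applyUpTo f (suc k)) ≡ applyUpTo f (suc (suc k))
closingUp-applyUpTo f k eq =
  trans (cong (applyUpTo f (suc k) ∷ʳ_) (sym eq)) (applyUpTo-∷ʳ f (suc k))

-- The walk that continues a double helix

-- The order is n = suc m, and w is Z followed by x, so Z is seg (N + m) 0.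
module Helix (m N′ : ℕ) (N≡ : 2 ^ suc m ≡ suc N′) (w : ℕ → Bool) where

  open Windows w

  P : ℕ → Vec Bool (suc m)
  P = win (suc m)

  N : ℕ
  N = suc N′

  Rem : Vec Bool (suc m) → Vec Bool (suc m) → Set
  Rem = Remaining (suc m) (seg (N + m) 0)

  module Properties {Q} (short : ∀ σ → length σ ≤ suc m → Q σ)
    (covers : Covers (suc m) P)
    (components : HasComponents 3 Rem)
    (P0≢zeros : P 0 ≢ zeros (suc m)) (P0≢ones : P 0 ≢ ones (suc m))
    -- The digit `w (suc (k + N′) + m)` is the generated digit of index `k`; it completes the window
    -- `P (suc (k + N′))`.
    (next : ∀ k → Next Q (seg (suc (k + N′) + m) 0) (w (suc (k + N′) + m))) where

    covers′ : ∀ v → ∃[ i ] i < N × P i ≡ v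
    covers′ v with covers v
    ... | i , i<N , eq = i , subst (i <_) N≡ i<N , eq

    distinct : Distinct P N
    distinct = subst (Distinct P) N≡ (covers⇒distinct covers)

    P-injective : ∀ {i j} → i < N → j < N → P i ≡ P j → i ≡ j
    P-injective = distinct⇒injective distinct

    closes : win m N ≡ win m 0
    closes = subst (λ k → win m k ≡ win m 0) N≡
      (covers⇒closes (win m) covers
        (λ i → trans (cong Vec.init (win-▹ m i)) (init-∷ʳ _ (win m i))) (λ _ → refl))

    -- The digit generated after Z: win m 0 occurs in Z at 0, at a second
    -- place j, and at the end; the latest earlier occurrence is the one at j.
    first-digit : w (N + m) ≡ w m
    first-digit
      with next-window {a = N′} (λ σ → short σ ∘ m≤n⇒m≤1+n) (next 0) z≤n (sym closes)
                       (λ _ j<N′ → distinct j<N′ (n<1+n N′))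
         | covers′ (win m 0 ▹ not (w m))
    ... | i , i≤N′ , win≡ , w≡ , latest | j , j<N , Pj≡ with w m Bool.≟ w (i + m)
    ...   | no  wm≢ = trans w≡ (sym (Bool.¬-not wm≢))
    -- A latest occurrence followed by `w m` would be the one at 0, forcing `j` to be 0 as well,
    -- although the window at `j` ends in `not (w m)`.
    ...   | yes wm≡ = ⊥-elim (Bool.not-¬ {w m} refl (begin
            w m          ≡⟨ cong (λ k → w (k + m)) j≡0 ⟨
            w (j + m)    ≡⟨ Vec.∷ʳ-injectiveʳ (win m j) (win m 0) Pj≡′ ⟩
            not (w m)    ∎))
      where
      open ≡-Reasoning
      Pj≡′ : win m j ▹ w (j + m) ≡ win m 0 ▹ not (w m)
      Pj≡′ = trans (sym (win-▹ m j)) Pj≡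
      Pi≡P0 : P i ≡ P 0
      Pi≡P0 = trans (win-▹ m i)
        (trans (cong₂ _▹_ (trans win≡ closes) (sym wm≡)) (sym (win-▹ m 0)))
      j≤i : j ≤ i
      j≤i = latest j (s≤s⁻¹ j<N) (trans (∷ʳ-injectiveˡ (win m j) (win m 0) Pj≡′) (sym closes))
      j≡0 : j ≡ 0
      j≡0 = n≤0⇒n≡0 (subst (j ≤_) (P-injective (s≤s i≤N′) z<s Pi≡P0) j≤i)

    PN≡P0 : P N ≡ P 0
    PN≡P0 = trans (win-▹ m N) (trans (cong₂ _▹_ closes first-digit) (sym (win-▹ m 0)))

    -- By `PN≡P0` the closing edge is the step from `P N′` to `P N`, so the circuit is a run of
    -- consecutive steps of `P`.
    circuit≡ : circuit (suc m) (seg (N + m) 0) ≡ steps (applyUpTo P (suc N))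
    circuit≡ = begin
      circuit (suc m) (seg (N + m) 0)
        ≡⟨ cong (λ L → circuit (suc m) (seg L 0)) (+-suc N′ m) ⟨
      circuit (suc m) (seg (N′ + suc m) 0)
        ≡⟨ cong (steps ∘ closingUp) (trans (inducedPath-seg m N′ 0)
             (applyUpTo-cong (λ j → cong P (+-identityʳ j)) N)) ⟩
      steps (closingUp (applyUpTo P N))
        ≡⟨ cong steps (closingUp-applyUpTo P N′ PN≡P0) ⟩
      steps (applyUpTo P (suc N))
        ∎
      where open ≡-Reasoning

    circuit⁺ : ∀ {i} → i < N → (P i , P (suc i)) ∈ circuit (suc m) (seg (N + m) 0)
    circuit⁺ {i} i<N = subst (stepAt P i ∈_) (sym circuit≡) (∈-steps⁺ P i<N)

    circuit⁻ : ∀ {u v} → (u , v) ∈ circuit (suc m) (seg (N + m) 0) →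
               ∃[ i ] i < N × u ≡ P i × v ≡ P (suc i)
    circuit⁻ {u} {v} e = ∈-steps⁻ P (subst ((u , v) ∈_) circuit≡ e)

    edge-P : ∀ i → Edge (P i) (P (suc i))
    edge-P i = edge (w i) (win m (suc i)) (w (suc i + m)) (win-▹ m (suc i))

    rem≢circuit : ∀ {u v} → Rem u v → ∀ {i} → i < N → P i ≡ u → P (suc i) ≢ v
    rem≢circuit (_ , ∉c) i<N refl refl = ∉c (circuit⁺ i<N)

    functional : ∀ {u v v′} → Rem u v → Rem u v′ → v ≡ v′
    functional {u} r r′ with covers′ u
    ... | i , i<N , refl = edges-out (proj₁ r) (proj₁ r′) (edge-P i)
      (rem≢circuit r i<N refl ∘ sym) (rem≢circuit r′ i<N refl ∘ sym)

    predecessor : ∀ v → ∃[ i ] i < N × P (suc i) ≡ v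
    predecessor v with covers′ v
    ... | zero  , _   , eq = N′ , n<1+n N′ , trans PN≡P0 eq
    ... | suc i , i<N , eq = i , <-trans (n<1+n i) i<N , eq

    injective : ∀ {u u′ v} → Rem u v → Rem u′ v → u ≡ u′
    injective {v = v} r r′ with predecessor v
    ... | i , i<N , refl = edges-in (proj₁ r) (proj₁ r′) (edge-P i)
      (λ u≡ → rem≢circuit r i<N (sym u≡) refl) (λ u≡ → rem≢circuit r′ i<N (sym u≡) refl)

    -- A loop on the circuit would make two consecutive windows of `Z` equal, unless it were the
    -- closing edge, which ends at `P 0`.
    rem-loop : ∀ {v} → Edge v v → P 0 ≢ v → Rem v v
    rem-loop {v} e P0≢v = e , λ ∈c → ∉c (circuit⁻ ∈c)
      where
      ∉c : ¬ (∃[ i ] i < N × v ≡ P i × v ≡ P (suc i))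
      ∉c (i , i<N , v≡Pi , v≡Psi) with m≤n⇒m<n∨m≡n i<N
      ... | inj₁ si<N = distinct (n<1+n i) si<N (trans (sym v≡Pi) v≡Psi)
      ... | inj₂ refl = P0≢v (trans (sym PN≡P0) (sym v≡Psi))

    loop-zeros : Rem (zeros (suc m)) (zeros (suc m))
    loop-zeros = rem-loop (loop-edge m false) P0≢zeros

    loop-ones : Rem (ones (suc m)) (ones (suc m))
    loop-ones = rem-loop (loop-edge m true) P0≢ones

    -- The closing edge of the circuit leads from P N′ to P N, which equals P 0;
    -- the path induced by τ₋Y starts there.
    visit : ℕ → Vec Bool (suc m)
    visit k = P (suc (k + N′))

    position : ∀ j → j < N ⊎ ∃[ k ] j ≡ suc (k + N′)
    position j with <-≤-connex j N
    ... | inj₁ j<N = inj₁ j<N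
    ... | inj₂ N≤j = inj₂ (j ∸ N , trans (sym (m∸n+n≡m N≤j)) (+-suc (j ∸ N) N′))

    -- The window at `k + N′` is the edge into `visit k`. A copy among the visits would repeat a
    -- vertex; a copy on the circuit would be a remaining edge. For `k` equal to 0 the edge is the
    -- closing one, and distinctness of the windows of `Z` excludes a copy.
    fresh-edge : ∀ k → Distinct visit (suc k) → (∀ k′ → suc k′ ≡ k → Rem (visit k′) (visit k)) →
      ∀ j → j < k + N′ → win (suc (suc m)) j ≢ win (suc (suc m)) (k + N′)
    fresh-edge k d previous j j<a eq with position j
    ... | inj₂ (k′ , refl) = d (+-cancelʳ-≤ N′ _ _ j<a) (n<1+n k) (Vec.∷-injectiveʳ eq)
    fresh-edge zero d previous j j<N′ eq | inj₁ _ =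
      distinct z<s (s<s j<N′) (sym (trans (Vec.∷-injectiveʳ eq) PN≡P0))
    fresh-edge (suc k) d previous j _ eq | inj₁ j<N =
      rem≢circuit (previous k refl) j<N
        (∷ʳ-injectiveˡ (P j) (visit k)
          (trans (sym (win-▹ (suc m) j)) (trans eq (win-▹ (suc m) (suc (k + N′))))))
        (Vec.∷-injectiveʳ eq)

    follows : ∀ k → Distinct visit (suc k) → Rem (visit k) (visit (suc k))
    follows k d with covers′ (visit k)
    ... | i₀ , i₀<N , i₀≡ with next-window {a = k + N′} short
            (subst (λ L → Next Q (seg L 0) (w L)) (sym (+-suc (suc (k + N′)) m)) (next (suc k)))
            (≤-trans (s≤s⁻¹ i₀<N) (m≤n+m N′ k)) i₀≡ (fresh-edge k d (previous k d))
      where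
      -- The recursion: the edge into `visit (suc k)` is the instance of `follows` at `k`.
      previous : ∀ k → Distinct visit (suc k) → ∀ k′ → suc k′ ≡ k → Rem (visit k′) (visit k)
      previous (suc k) d _ refl = follows k (λ p q → d p (m<n⇒m<1+n q))
    ...   | i , i≤a , Pi≡ , w≡ , _ with position i
    -- A match at an earlier visit would repeat a vertex. Hence the match lies in `Z`, and the new
    -- digit is opposite to the one by which the circuit leaves.
    ...     | inj₂ (k′ , refl) = ⊥-elim (d (+-cancelʳ-≤ N′ _ _ i≤a) (n<1+n k) Pi≡)
    ...     | inj₁ i<N = edge-P (suc (k + N′)) , λ ∈c → ∉c (circuit⁻ ∈c)
      where
      a = suc (k + N′)
      ∉c : ¬ (∃[ j ] j < N × visit k ≡ P j × visit (suc k) ≡ P (suc j))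
      ∉c (j , j<N , eq , eq′) with P-injective i<N j<N (trans Pi≡ eq)
      ... | refl = Bool.not-¬ (Vec.∷ʳ-injectiveʳ (win m (suc a)) (win m (suc i))
                     (trans (sym (win-▹ m (suc a))) (trans eq′ (win-▹ m (suc i)))))
                   (trans (cong w (sym (+-suc a m))) (trans w≡ (cong (not ∘ w) (+-suc i m))))

    open Loop {R = Rem} functional injective components
      {zeros (suc m)} {ones (suc m)} (λ ()) loop-zeros loop-ones
      visit (P0≢zeros ∘ trans (sym PN≡P0)) (P0≢ones ∘ trans (sym PN≡P0)) follows
      public renaming (distinct to visit-distinct; closes to visit-closes)

    visit-injective : ∀ {i j} → i ≤ l → j ≤ l → visit i ≡ visit j → i ≡ j
    visit-injective i≤l j≤l = distinct⇒injective visit-distinct (s≤s i≤l) (s≤s j≤l)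

    -- The cycle has `suc l` edges, so its closed path has `N′` vertices, one for each digit of `Y`.
    N′≡ : N′ ≡ 2 + l
    N′≡ = suc-injective (trans (sym N≡) orbit-length)

    path : List (Vec Bool (suc m))
    path = applyUpTo visit (suc (suc l))

    path-closed : Closed path
    path-closed = visit 0 , applyUpTo (visit ∘ suc) l ,
      cong (visit 0 ∷_) (trans (sym (applyUpTo-∷ʳ (visit ∘ suc) l))
                              (cong (applyUpTo (visit ∘ suc) l ∷ʳ_) visit-closes))

    path-traverses : TraversesOnce path (MessageLoop (suc m) (seg (N + m) 0))
    path-traverses = subst Unique (sym (steps-applyUpTo visit (suc l)))
        (Unique.applyUpTo⁺₁ (stepAt visit) (suc l)
          λ i<j j<1+l → visit-distinct i<j j<1+l ∘ cong proj₁) ,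
      λ u v → mk⇔ (to ∘ ∈-steps⁻ visit) (λ e → from e (on-orbit e))
      where
      to : ∀ {u v} → ∃[ k ] k < suc l × u ≡ visit k × v ≡ visit (suc k) →
           MessageLoop (suc m) (seg (N + m) 0) u v
      to (k , s≤s k≤l , refl , refl) = step k≤l ,
        orbit≢a k k≤l ∘ loop-class loop-zeros ∘ symmetric Rem ,
        orbit≢b k k≤l ∘ loop-class loop-ones ∘ symmetric Rem

      ≁⇒≢ : ∀ {u v} → ¬ EqClosure Rem u v → u ≢ v
      ≁⇒≢ ≁ refl = ≁ ε

      on-orbit : ∀ {u v} → MessageLoop (suc m) (seg (N + m) 0) u v → OnOrbit u
      on-orbit (_ , ≁zeros , ≁ones) = others-on-orbit (≁⇒≢ ≁zeros) (≁⇒≢ ≁ones)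

      from : ∀ {u v} → MessageLoop (suc m) (seg (N + m) 0) u v → OnOrbit u → (u , v) ∈ steps path
      from (r , _) (k , k≤l , refl) =
        subst (λ v → (visit k , v) ∈ steps path) (functional (step k≤l) r)
          (∈-steps⁺ visit {k} {suc l} (s≤s k≤l))

    visits-induced : inducedPath (suc m) (seg (m + N′) N) ≡ path
    visits-induced = begin
      inducedPath (suc m) (seg (m + N′) N)
        ≡⟨ cong (λ L → inducedPath (suc m) (seg L N)) m+N′≡ ⟩
      inducedPath (suc m) (seg (suc l + suc m) N)
        ≡⟨ inducedPath-seg m (suc l) N ⟩
      applyUpTo (λ j → P (j + N)) (suc (suc l))
        ≡⟨ applyUpTo-cong (λ j → cong P (+-suc j N′)) (suc (suc l)) ⟩
      path
        ∎
      where
      open ≡-Reasoning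
      m+N′≡ : m + N′ ≡ suc l + suc m
      m+N′≡ = trans (+-comm m N′) (trans (cong (_+ m) N′≡) (sym (+-suc (suc l) m)))

    -- Strings of length n + 1 in `ZY`

    ZY : Str
    ZY = seg (N + m + N′) 0

    -- The start positions of windows of length n + 1: first the `N` circuit edges, the closing one
    -- included, then the `suc l` edges of the message loop.
    InRange : ℕ → Set
    InRange e = e < N ⊎ ∃[ k ] k ≤ l × e ≡ suc (k + N′)

    length≡ : N + m + N′ ≡ N′ + N′ + suc m
    length≡ = begin
      suc (N′ + m + N′)      ≡⟨ cong suc (+-assoc N′ m N′) ⟩
      suc (N′ + (m + N′))    ≡⟨ cong (λ k → suc (N′ + k)) (+-comm m N′) ⟩
      suc (N′ + (N′ + m))    ≡⟨ cong suc (+-assoc N′ N′ m) ⟨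
      suc (N′ + N′ + m)      ≡⟨ +-suc (N′ + N′) m ⟨
      N′ + N′ + suc m        ∎
      where open ≡-Reasoning

    inRange⁻ : ∀ {e} → e + suc (suc m) ≤ N + m + N′ → InRange e
    inRange⁻ {e} e+n≤ = [ inj₁ , inj₂ ∘ onLoop ]′ (position e)
      where
      e<2N′ : e < N′ + N′
      e<2N′ = +-cancelʳ-≤ (suc m) _ _ (subst₂ _≤_ (+-suc e (suc m)) length≡ e+n≤)
      onLoop : ∃[ k ] e ≡ suc (k + N′) → ∃[ k ] k ≤ l × e ≡ suc (k + N′)
      onLoop (k , refl) =
        k , s≤s⁻¹ (s≤s⁻¹ (subst (suc (suc k) ≤_) N′≡ (+-cancelʳ-≤ N′ _ _ e<2N′))) , refl

    inRange⁺ : ∀ {e} → InRange e → e + suc (suc m) ≤ N + m + N′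
    inRange⁺ {e} r = subst₂ _≤_ (sym (+-suc e (suc m))) (sym length≡) (+-monoˡ-≤ (suc m) (e<2N′ r))
      where
      2+k≤N′ : ∀ {k} → k ≤ l → suc (suc k) ≤ N′
      2+k≤N′ k≤l = subst (_ ≤_) (sym N′≡) (s≤s (s≤s k≤l))
      e<2N′ : ∀ {e} → InRange e → e < N′ + N′
      e<2N′ (inj₁ e<N)             = ≤-trans e<N (+-monoˡ-≤ N′ (≤-trans (n≤1+n 1) (2+k≤N′ z≤n)))
      e<2N′ (inj₂ (k , k≤l , refl)) = +-monoˡ-≤ N′ (2+k≤N′ k≤l)

    -- A string of length n + 1 is the edge from `x ∷ ρ` to `ρ ▹ y`; its occurrences are the
    -- traversals of that edge.
    module Word (x : Bool) (ρ : Vec Bool m) (y : Bool) where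

      word : Vec Bool (suc (suc m))
      word = x ∷ (ρ ▹ y)

      At : ℕ → Set
      At e = InRange e × P e ≡ x ∷ ρ × P (suc e) ≡ ρ ▹ y

      at⁺ : ∀ {e} → At e → OccursAt e (toList word) ZY
      at⁺ {e} (r , eq , eq′) = subst (λ v → OccursAt e (toList v) ZY)
        (cong₂ _∷_ (Vec.∷-injectiveˡ eq) eq′) (occursAt⁺ (inRange⁺ r))

      at⁻ : ∀ {e} → OccursAt e (toList word) ZY → At e
      at⁻ {e} o = inRange⁻ (proj₁ o′) ,
        ∷ʳ-injectiveˡ (P e) (x ∷ ρ) (trans (sym (win-▹ (suc m) e)) (proj₂ o′)) ,
        Vec.∷-injectiveʳ (proj₂ o′)
        where o′ = occursAt-toList⁻ word o

      once-on-circuit : ∀ {i} → i < N → P i ≡ x ∷ ρ → P (suc i) ≡ ρ ▹ y →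
                        OccursOnce (toList word) ZY
      once-on-circuit {i} i<N eq eq′ = i , at⁺ (inj₁ i<N , eq , eq′) , unique ∘ at⁻
        where
        unique : ∀ {e} → At e → i ≡ e
        unique (inj₁ e<N , eq₁ , _) = P-injective i<N e<N (trans eq (sym eq₁))
        unique (inj₂ (k , k≤l , refl) , eq₁ , eq₁′) =
          ⊥-elim (rem≢circuit (step k≤l) i<N (trans eq (sym eq₁)) (trans eq′ (sym eq₁′)))

      once-on-loop : ∀ {k} → k ≤ l → visit k ≡ x ∷ ρ → visit (suc k) ≡ ρ ▹ y →
                     OccursOnce (toList word) ZY
      once-on-loop {k} k≤l eq eq′ =
        suc (k + N′) , at⁺ (inj₂ (k , k≤l , refl) , eq , eq′) , unique ∘ at⁻
        where
        unique : ∀ {e} → At e → suc (k + N′) ≡ e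
        unique (inj₁ e<N , eq₁ , eq₁′) =
          ⊥-elim (rem≢circuit (step k≤l) e<N (trans eq₁ (sym eq)) (trans eq₁′ (sym eq′)))
        unique (inj₂ (k₁ , k₁≤l , refl) , eq₁ , _) =
          cong (λ j → suc (j + N′)) (visit-injective k≤l k₁≤l (trans eq (sym eq₁)))

      absent : Rem (x ∷ ρ) (ρ ▹ y) → (∀ k → k ≤ l → visit k ≢ x ∷ ρ) →
               ¬ Substring (toList word) ZY
      absent r off s = no-at (at⁻ (proj₂ (substring⇒occursAt s)))
        where
        no-at : ∀ {e} → ¬ At e
        no-at (inj₁ e<N , eq , eq′)              = rem≢circuit r e<N eq eq′
        no-at (inj₂ (k , k≤l , refl) , eq , _) = off k k≤l eq

      -- The only remaining edge out of a constant vertex is its loop, which spells a constant word.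
      not-loop : ∀ {b} → Rem (replicate (suc m) b) (replicate (suc m) b) →
                 Rem (x ∷ ρ) (ρ ▹ y) → word ≢ replicate (suc (suc m)) b →
                 x ∷ ρ ≢ replicate (suc m) b
      not-loop {b} loop r word≢ eq = word≢ (cong₂ _∷_ (Vec.∷-injectiveˡ eq)
        (functional (subst (λ u → Rem u (ρ ▹ y)) eq r) loop))

      once : word ≢ zeros (suc (suc m)) → word ≢ ones (suc (suc m)) → OccursOnce (toList word) ZY
      once ≢zeros ≢ones = go (covers′ (x ∷ ρ))
        where
        loop-case : Rem (x ∷ ρ) (ρ ▹ y) → OnOrbit (x ∷ ρ) → OccursOnce (toList word) ZY
        loop-case r (k , k≤l , eq) =
          once-on-loop k≤l eq (functional (subst (λ u → Rem u (visit (suc k))) eq (step k≤l)) r)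

        go : ∃[ i ] i < N × P i ≡ x ∷ ρ → OccursOnce (toList word) ZY
        go (i , i<N , eq) = decide (≡-dec Bool._≟_ (P (suc i)) (ρ ▹ y))
          where
          off-circuit : P (suc i) ≢ ρ ▹ y → Rem (x ∷ ρ) (ρ ▹ y)
          off-circuit ≢ = edge x ρ y refl , λ ∈c → ∉c (circuit⁻ ∈c)
            where
            ∉c : ¬ (∃[ j ] j < N × x ∷ ρ ≡ P j × ρ ▹ y ≡ P (suc j))
            ∉c (j , j<N , eq₁ , eq₁′) =
              ≢ (trans (cong (P ∘ suc) (P-injective i<N j<N (trans eq eq₁))) (sym eq₁′))

          decide : Dec (P (suc i) ≡ ρ ▹ y) → OccursOnce (toList word) ZY
          decide (yes eq′) = once-on-circuit i<N eq eq′
          decide (no ≢)    = loop-case r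
            (others-on-orbit (not-loop loop-zeros r ≢zeros) (not-loop loop-ones r ≢ones))
            where r = off-circuit ≢

    absent-loop : ∀ b → Rem (replicate (suc m) b) (replicate (suc m) b) →
      (∀ k → k ≤ l → visit k ≢ replicate (suc m) b) →
      ¬ Substring (toList (replicate (suc (suc m)) b)) ZY
    absent-loop b loop off = subst (λ s → ¬ Substring (toList (b ∷ s)) ZY) (sym (replicate-▹ m b))
      (Word.absent b (replicate m b) b
        (subst (Rem (replicate (suc m) b)) (replicate-▹ m b) loop) off)

    depleted : Depleted (suc (suc m)) ZY
    depleted = once ,
      -- Both constant strings are absent: since τ is not constant, neither the circuit nor the
      -- orbit contains a loop.
      inj₂ (inj₂ (absent-loop false loop-zeros orbit≢a , absent-loop true loop-ones orbit≢b))
      where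
      once : ∀ t → t ≢ zeros (suc (suc m)) → t ≢ ones (suc (suc m)) → OccursOnce (toList t) ZY
      once (x ∷ s) = snoc (initLast s)
        where
        snoc : ∀ {s} → ∃[ ρ ] ∃[ y ] s ≡ ρ ▹ y → x ∷ s ≢ zeros (suc (suc m)) →
               x ∷ s ≢ ones (suc (suc m)) → OccursOnce (toList (x ∷ s)) ZY
        snoc (ρ , y , refl) = Word.once x ρ y

-- Transfer to the seed and its generated sequence

extend : Str → (ℕ → Bool) → ℕ → Bool
extend []      x i       = x i
extend (b ∷ Z) x zero    = b
extend (b ∷ Z) x (suc i) = extend Z x i

extend-+ : ∀ Z x k → extend Z x (length Z + k) ≡ x k
extend-+ []      x k = refl
extend-+ (b ∷ Z) x k = extend-+ Z x k

open Windows

win-suc : ∀ w ℓ i → win w ℓ (suc i) ≡ win (w ∘ suc) ℓ i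
win-suc w zero    i = refl
win-suc w (suc ℓ) i = cong (w (suc i) ∷_) (win-suc w ℓ (suc i))

extend-seg : ∀ Z x k → seg (extend Z x) (length Z + k) 0 ≡ Z ++ applyUpTo x k
extend-seg []      x zero    = refl
extend-seg []      x (suc k) =
  cong (x 0 ∷_) (trans (cong toList (win-suc x k 0)) (extend-seg [] (x ∘ suc) k))
extend-seg (b ∷ Z) x k       =
  cong (b ∷_)
    (trans (cong toList (win-suc (extend (b ∷ Z) x) (length Z + k) 0)) (extend-seg Z x k))

Conclusion : ℕ → Str → Str → Set
Conclusion n Z Y =
  (Closed (inducedPath n (dropLast (take n Z) ++ Y))
    × TraversesOnce (inducedPath n (dropLast (take n Z) ++ Y)) (MessageLoop n Z))
  × Depleted (suc n) (Z ++ Y)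

-- Both kinds of sequence are treated at once: `Q` may be any condition that admits all tails of
-- length at most n.
module _ {m} (Z : Str) (helix : DoubleHelix (suc m) Z)
  (τ≢zeros : take (suc m) Z ≢ toList (zeros (suc m)))
  (τ≢ones : take (suc m) Z ≢ toList (ones (suc m)))
  {Q} (short : ∀ σ → length σ ≤ suc m → Q σ) {x} (generated : GeneratedFrom Q Z x) where

  private
    N′ : ℕ
    N′ = 2 ^ suc m ∸ 1

    N≡ : 2 ^ suc m ≡ suc N′
    N≡ = sym (m+[n∸m]≡n (m^n>0 2 (suc m)))

    w : ℕ → Bool
    w = extend Z x

    open Helix m N′ N≡ w

    length-Z : length Z ≡ N + m
    length-Z = trans (proj₁ (proj₁ helix))
      (trans (cong (_∸ 1) (+-suc (2 ^ suc m) m)) (cong (_+ m) N≡))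

    Z++≡ : ∀ k → seg w (N + m + k) 0 ≡ Z ++ applyUpTo x k
    Z++≡ k = trans (cong (λ L → seg w (L + k) 0) (sym length-Z)) (extend-seg Z x k)

    Z≡ : seg w (N + m) 0 ≡ Z
    Z≡ = trans (cong (λ L → seg w L 0) (sym (+-identityʳ (N + m)))) (trans (Z++≡ 0) (++-identityʳ Z))

    τ≡ : seg w (suc m) 0 ≡ take (suc m) Z
    τ≡ = trans (sym (take-seg w (suc m) N′ 0)) (cong (take (suc m))
      (trans (cong (λ L → seg w (suc L) 0) (+-comm m N′)) Z≡))

    covers : Covers (suc m) P
    covers v = located (substring⇒occursAt (proj₂ (proj₁ helix) v))
      where
      located : ∃[ i ] OccursAt i (toList v) Z → ∃[ i ] i < 2 ^ suc m × P i ≡ v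
      located (i , o) = i ,
        subst (i <_) (sym N≡) (s≤s (+-cancelʳ-≤ (suc m) _ _
          (subst (i + suc m ≤_) (sym (+-suc N′ m)) (proj₁ o′)))) ,
        proj₂ o′
        where o′ = occursAt-toList⁻ w v (subst (OccursAt i (toList v)) (sym Z≡) o)

    next : ∀ k → Next Q (seg w (suc (k + N′) + m) 0) (w (suc (k + N′) + m))
    next k = subst₂ (Next Q)
      (trans (sym (Z++≡ k)) (cong (λ L → seg w L 0) index≡))
      (trans (sym (extend-+ Z x k)) (cong w (trans (cong (_+ k) length-Z) index≡)))
      (generated k)
      where
      index≡ : N + m + k ≡ suc (k + N′) + m
      index≡ = cong suc (trans (+-comm (N′ + m) k) (sym (+-assoc k N′ m)))

    module H = Properties short covers
      (subst (λ V → HasComponents 3 (Remaining (suc m) V)) (sym Z≡) (proj₂ helix))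
      (τ≢zeros ∘ trans (sym τ≡) ∘ cong toList) (τ≢ones ∘ trans (sym τ≡) ∘ cong toList) next

    Y : Str
    Y = applyUpTo x N′

    Y≡ : Y ≡ seg w N′ (m + N)
    Y≡ = trans (proj₂ (proj₂ (seg-split w Z (Z++≡ N′)))) (cong₂ (seg w) (length-applyUpTo x N′)
      (trans (+-identityʳ _) (trans length-Z (+-comm N m))))

    path≡ : inducedPath (suc m) (dropLast (take (suc m) Z) ++ Y) ≡ H.path
    path≡ = trans (cong (inducedPath (suc m)) (begin
      dropLast (take (suc m) Z) ++ Y
        ≡⟨ cong₂ (λ τ Y → dropLast τ ++ Y) (sym τ≡) Y≡ ⟩
      dropLast (seg w (suc m) 0) ++ seg w N′ (m + N)
        ≡⟨ cong (_++ seg w N′ (m + N))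
             (trans (dropLast-seg w m 0) (cong toList (sym H.closes))) ⟩
      seg w m N ++ seg w N′ (m + N)
        ≡⟨ seg-++ w m N′ N ⟨
      seg w (m + N′) N
        ∎)) H.visits-induced
      where open ≡-Reasoning

  double-helix-continuation : Conclusion (suc m) Z (applyUpTo x (2 ^ suc m ∸ 1))
  double-helix-continuation =
    (subst Closed (sym path≡) H.path-closed ,
     subst₂ (λ p V → TraversesOnce p (MessageLoop (suc m) V)) (sym path≡) Z≡ H.path-traverses) ,
    subst (Depleted (suc (suc m))) (Z++≡ N′) H.depleted

theorem4p1 : (n : ℕ) → 1 ≤ n → (Z : Str) → DoubleHelix n Z →
    (τ : Str) → τ ≡ take n Z → τ ≢ toList (zeros n) → τ ≢ toList (ones n) →
    (x : ℕ → Bool) → IsEMₙ n Z x ⊎ IsEM Z x →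
    (Y : Str) → Y ≡ applyUpTo x (2 ^ n ∸ 1) →
    (Closed (inducedPath n (dropLast τ ++ Y))
    × TraversesOnce (inducedPath n (dropLast τ ++ Y)) (MessageLoop n Z))
    × Depleted (suc n) (Z ++ Y)
theorem4p1 (suc m) _ Z helix τ refl τ≢zeros τ≢ones x (inj₁ em) Y refl =
  double-helix-continuation Z helix τ≢zeros τ≢ones (λ _ σ≤n → σ≤n) em
theorem4p1 (suc m) _ Z helix τ refl τ≢zeros τ≢ones x (inj₂ em) Y refl =
  double-helix-continuation Z helix τ≢zeros τ≢ones (λ _ _ → tt) em
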